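{- Let $p$ be an odd prime. Define $\mathcal{B}_0=-\frac1p\in\mathbb{Q}_p$ and $\mathcal{B}_n=\frac{B_n}{n}\in\mathbb{Q}_p$ for $n\ge1$, where $B_n$ are the Bernoulli numbers (with $B_1=-\tfrac12$). Then $$\sum_{k=0}^{p-1}\frac{\mathcal{B}_k}{2^k}\equiv 0\pmod p,$$ i.e. this sum lies in $p\mathbb{Z}_p$.
   Context: $\mathbb{Q}_p$ denotes the field of $p$-adic numbers and $\mathbb{Z}_p$ its ring of integers. -}

module Defs where

open import Data.Nat as ℕ using (ℕ; zero; suc; NonZero)
open import Data.Nat.Combinatorics using (_C_)
open import Data.Nat.Divisibility using (_∣_)
open import Data.Integer as ℤ using (+_)
open import Data.Rational using (ℚ; _/_; _+_; _*_; -_; 0ℚ; 1ℚ; ↥_; ↧ₙ_)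
open import Data.List using (List; []; _∷_; map; zipWith; upTo; reverse; foldr)
open import Data.Product using (_×_)
open import Relation.Nullary using (¬_)

sumℚ : List ℚ → ℚ
sumℚ = foldr _+_ 0ℚ

_^ℚ_ : ℚ → ℕ → ℚ
q ^ℚ zero = 1ℚ
q ^ℚ suc k = q * (q ^ℚ k)

-- Given [B_0,…,B_{n-1}], compute B_n via  Σ_{k=0}^{n} C(n+1,k) B_k = 0  (n ≥ 1), B_0 = 1
nextBern : ℕ → List ℚ → ℚ
nextBern n bs =
  - ((+ 1 / suc n) * sumℚ (zipWith (λ k b → (+ (suc n C k) / 1) * b) (upTo n) bs))

-- bernRev n = [B_{n-1}, …, B_0]  (B_0 = 1)
bernRev : ℕ → List ℚ
bernRev zero = []
bernRev (suc zero) = 1ℚ ∷ []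
bernRev (suc n) = nextBern n (reverse (bernRev n)) ∷ bernRev n

headOr0 : List ℚ → ℚ
headOr0 [] = 0ℚ
headOr0 (x ∷ _) = x

-- Bernoulli numbers B_n, with B_0 = 1, B_1 = -1/2
bernoulli : ℕ → ℚ
bernoulli n = headOr0 (bernRev (suc n))

calB : (p : ℕ) → .{{NonZero p}} → ℕ → ℚ
calB p zero = - (+ 1 / p)
calB p (suc n) = bernoulli (suc n) * (+ 1 / suc n)

-- a rational q lies in p ℤ_p  (q = a/b in lowest terms with p ∣ a and p ∤ b)
InpZp : ℕ → ℚ → Set
InpZp p q = (p ∣ ℤ.∣ ↥ q ∣) × ¬ (p ∣ ↧ₙ q)

{-# OPTIONS --safe #-}
module Submission where

-- For b k = B_k (-½)^k, the relation B_n(x+1) = B_n(x) + n x^(n-1), applied twice, evaluates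
--   1/p + Σ_{1≤k<p} C(p-1,k-1) 𝓑_k (-½)^k = ½ (1 + 2^(1-p)).
-- Since C(p-1,k-1) ≡ (-1)^(k-1) mod p and 𝓑_k is p-integral for k < p-1, adding this to the sum
-- of the theorem cancels all terms mod p except those with k = p-1, where C(p-1,p-2) = p-1 leaves
-- p 𝓑_{p-1} 2^(1-p). The claim follows from p 𝓑_{p-1} ≡ 1 and 2^(p-1) ≡ 1 mod p.

open import Defs
open import Data.Nat as ℕ using (ℕ; zero; suc; NonZero; z≤n; s≤s; s<s)
import Data.Nat.Properties as ℕ
open import Data.Nat.Combinatorics using (_C_; nCn≡1; nCk≡nC[n∸k]; nCk+nC[k+1]≡[n+1]C[k+1]; k>n⇒nCk≡0)
open import Data.Nat.Coprimality using (recompute)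
open import Data.Nat.Divisibility using (_∣_; _∤_; >⇒∤; ∣m⇒∣m*n; ∣m∣n⇒∣m+n; ∣-refl)
open import Data.Nat.Primality using (Prime; euclidsLemma; irreducible[2]; prime⇒irreducible; prime⇒nonTrivial)
open import Data.Rational using (ℚ; mkℚ; _/_; _+_; _*_; -_; 0ℚ; 1ℚ; toℚᵘ; ½; -½)
open import Data.Rational.Properties
open import Data.Rational.Solver using (module +-*-Solver)
import Data.Rational.Unnormalised as ℚᵘ
import Data.Rational.Unnormalised.Properties as ℚᵘ
open import Data.Integer as ℤ using (ℤ; +_)
import Data.Integer.Properties as ℤ
open import Data.List using (_∷_; map; upTo; applyUpTo; applyDownFrom; zipWith; reverse)
open import Data.List.Properties using (map-upTo; reverse-applyDownFrom)
open import Data.Product using (_,_)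
open import Data.Sum using (_⊎_; inj₁; inj₂; [_,_]′)
open import Data.Empty using (⊥-elim)
open import Function using (_∘_; id)
open import Relation.Binary.PropositionalEquality
open +-*-Solver using (solve; _:=_; _:+_; _:*_; :-_; con)

-- Integers and natural numbers inside the rationals.

infixr 8 _^_
_^_ : ℚ → ℕ → ℚ
_^_ = _^ℚ_

fromℤ : ℤ → ℚ
fromℤ i = i / 1

fromℕ : ℕ → ℚ
fromℕ n = fromℤ (+ n)

-- `_/_` divides by a gcd, which does not compute on variables, so the laws below are checked on
-- unnormalised fractions.
toℚᵘ-/ : ∀ i n → toℚᵘ (i / suc n) ℚᵘ.≃ (i ℚᵘ./ suc n)
toℚᵘ-/ i n = toℚᵘ-fromℚᵘ (i ℚᵘ./ suc n)

fromℤ-homo-+ : ∀ i j → fromℤ (i ℤ.+ j) ≡ fromℤ i + fromℤ j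
fromℤ-homo-+ i j = toℚᵘ-injective (begin-equality
  toℚᵘ (fromℤ (i ℤ.+ j))                ≃⟨ toℚᵘ-/ (i ℤ.+ j) 0 ⟩
  (i ℤ.+ j) ℚᵘ./ 1                      ≃⟨ ℚᵘ.*≡* (cong (ℤ._* ℤ.1ℤ) (sym (cong₂ ℤ._+_ (ℤ.*-identityʳ i) (ℤ.*-identityʳ j)))) ⟩
  (i ℚᵘ./ 1) ℚᵘ.+ (j ℚᵘ./ 1)            ≃⟨ ℚᵘ.+-cong (toℚᵘ-/ i 0) (toℚᵘ-/ j 0) ⟨
  toℚᵘ (fromℤ i) ℚᵘ.+ toℚᵘ (fromℤ j)    ≃⟨ toℚᵘ-homo-+ (fromℤ i) (fromℤ j) ⟨
  toℚᵘ (fromℤ i + fromℤ j)              ∎)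
  where open ℚᵘ.≤-Reasoning

fromℤ-homo-* : ∀ i j → fromℤ (i ℤ.* j) ≡ fromℤ i * fromℤ j
fromℤ-homo-* i j = toℚᵘ-injective (begin-equality
  toℚᵘ (fromℤ (i ℤ.* j))                ≃⟨ toℚᵘ-/ (i ℤ.* j) 0 ⟩
  (i ℚᵘ./ 1) ℚᵘ.* (j ℚᵘ./ 1)            ≃⟨ ℚᵘ.*-cong (toℚᵘ-/ i 0) (toℚᵘ-/ j 0) ⟨
  toℚᵘ (fromℤ i) ℚᵘ.* toℚᵘ (fromℤ j)    ≃⟨ toℚᵘ-homo-* (fromℤ i) (fromℤ j) ⟨
  toℚᵘ (fromℤ i * fromℤ j)              ∎)
  where open ℚᵘ.≤-Reasoning

fromℕ-homo-+ : ∀ m n → fromℕ (m ℕ.+ n) ≡ fromℕ m + fromℕ n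
fromℕ-homo-+ m n = fromℤ-homo-+ (+ m) (+ n)

fromℕ-homo-* : ∀ m n → fromℕ (m ℕ.* n) ≡ fromℕ m * fromℕ n
fromℕ-homo-* m n = trans (cong fromℤ (ℤ.pos-* m n)) (fromℤ-homo-* (+ m) (+ n))

fromℕ-suc : ∀ n → fromℕ (suc n) ≡ 1ℚ + fromℕ n
fromℕ-suc = fromℕ-homo-+ 1

*-inverse-fromℕ : ∀ n → fromℕ (suc n) * (+ 1 / suc n) ≡ 1ℚ
*-inverse-fromℕ n = toℚᵘ-injective (begin-equality
  toℚᵘ (fromℕ (suc n) * (+ 1 / suc n))            ≃⟨ toℚᵘ-homo-* (fromℕ (suc n)) (+ 1 / suc n) ⟩
  toℚᵘ (fromℕ (suc n)) ℚᵘ.* toℚᵘ (+ 1 / suc n)    ≃⟨ ℚᵘ.*-cong (toℚᵘ-/ (+ suc n) 0) (toℚᵘ-/ (+ 1) n) ⟩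
  (+ suc n ℚᵘ./ 1) ℚᵘ.* (+ 1 ℚᵘ./ suc n)          ≃⟨ ℚᵘ.*≡* (trans (ℤ.*-assoc (+ suc n) (+ 1) (+ 1)) (trans (ℤ.*-comm (+ suc n) (+ 1)) (cong (λ k → + 1 ℤ.* + k) (sym (ℕ.*-identityˡ (suc n)))))) ⟩
  ℚᵘ.1ℚᵘ                                          ∎)
  where open ℚᵘ.≤-Reasoning

-- Finite sums of rationals.

∑ : ℕ → (ℕ → ℚ) → ℚ
∑ n f = sumℚ (applyUpTo f n)

open ≡-Reasoning

∑-cong : ∀ n {f g : ℕ → ℚ} → f ≗ g → ∑ n f ≡ ∑ n g
∑-cong zero    f≗g = refl
∑-cong (suc n) f≗g = cong₂ _+_ (f≗g 0) (∑-cong n (f≗g ∘ suc))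

∑-+ : ∀ n f g → ∑ n (λ k → f k + g k) ≡ ∑ n f + ∑ n g
∑-+ zero    f g = refl
∑-+ (suc n) f g = trans (cong (_+_ (f 0 + g 0)) (∑-+ n (f ∘ suc) (g ∘ suc)))
  (solve 4 (λ a b c d → (a :+ b) :+ (c :+ d) := (a :+ c) :+ (b :+ d)) refl
    (f 0) (g 0) (∑ n (f ∘ suc)) (∑ n (g ∘ suc)))

∑-*ˡ : ∀ n x f → ∑ n (λ k → x * f k) ≡ x * ∑ n f
∑-*ˡ zero    x f = sym (*-zeroʳ x)
∑-*ˡ (suc n) x f = trans (cong (_+_ (x * f 0)) (∑-*ˡ n x (f ∘ suc))) (sym (*-distribˡ-+ x _ _))

∑-last : ∀ n f → ∑ (suc n) f ≡ ∑ n f + f n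
∑-last zero    f = +-comm (f 0) 0ℚ
∑-last (suc n) f = trans (cong (_+_ (f 0)) (∑-last n (f ∘ suc))) (sym (+-assoc (f 0) _ _))

-- Exponential generating functions.

-- Product of exponential generating functions: (a ⊛ b) n = Σ C(n,k) a k b (n-k),
-- defined through the Leibniz rule (shifting a sequence differentiates its generating function).
infixl 7 _⊛_
_⊛_ : (ℕ → ℚ) → (ℕ → ℚ) → ℕ → ℚ
(a ⊛ b) zero    = a 0 * b 0
(a ⊛ b) (suc n) = (a ∘ suc ⊛ b) n + (a ⊛ b ∘ suc) n

⊛-cong : ∀ {a a′ b b′} → a ≗ a′ → b ≗ b′ → a ⊛ b ≗ a′ ⊛ b′
⊛-cong p q zero    = cong₂ _*_ (p 0) (q 0)
⊛-cong p q (suc n) = cong₂ _+_ (⊛-cong (p ∘ suc) q n) (⊛-cong p (q ∘ suc) n)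

⊛-congˡ : ∀ {a b b′} → b ≗ b′ → a ⊛ b ≗ a ⊛ b′
⊛-congˡ = ⊛-cong (λ _ → refl)

⊛-congʳ : ∀ {a a′ b} → a ≗ a′ → a ⊛ b ≗ a′ ⊛ b
⊛-congʳ p = ⊛-cong p (λ _ → refl)

⊛-distribʳ-+ : ∀ c a b → (λ n → a n + b n) ⊛ c ≗ λ n → (a ⊛ c) n + (b ⊛ c) n
⊛-distribʳ-+ c a b zero    = *-distribʳ-+ (c 0) (a 0) (b 0)
⊛-distribʳ-+ c a b (suc n) = trans
  (cong₂ _+_ (⊛-distribʳ-+ c (a ∘ suc) (b ∘ suc) n) (⊛-distribʳ-+ (c ∘ suc) a b n))
  (solve 4 (λ s t u v → (s :+ t) :+ (u :+ v) := (s :+ u) :+ (t :+ v)) refl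
    ((a ∘ suc ⊛ c) n) ((b ∘ suc ⊛ c) n) ((a ⊛ c ∘ suc) n) ((b ⊛ c ∘ suc) n))

⊛-distribˡ-+ : ∀ c a b → c ⊛ (λ n → a n + b n) ≗ λ n → (c ⊛ a) n + (c ⊛ b) n
⊛-distribˡ-+ c a b zero    = *-distribˡ-+ (c 0) (a 0) (b 0)
⊛-distribˡ-+ c a b (suc n) = trans
  (cong₂ _+_ (⊛-distribˡ-+ (c ∘ suc) a b n) (⊛-distribˡ-+ c (a ∘ suc) (b ∘ suc) n))
  (solve 4 (λ s t u v → (s :+ t) :+ (u :+ v) := (s :+ u) :+ (t :+ v)) refl
    ((c ∘ suc ⊛ a) n) ((c ∘ suc ⊛ b) n) ((c ⊛ a ∘ suc) n) ((c ⊛ b ∘ suc) n))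

-- By the Leibniz rule both sides split into three terms, one for each differentiated factor, and
-- the induction hypothesis matches them.
⊛-assoc : ∀ a b c → a ⊛ b ⊛ c ≗ a ⊛ (b ⊛ c)
⊛-assoc a b c zero    = *-assoc (a 0) (b 0) (c 0)
⊛-assoc a b c (suc n) = begin
  ((a ⊛ b) ∘ suc ⊛ c) n + (a ⊛ b ⊛ c ∘ suc) n
    ≡⟨ cong (_+ (a ⊛ b ⊛ c ∘ suc) n) (⊛-distribʳ-+ c (a ∘ suc ⊛ b) (a ⊛ b ∘ suc) n) ⟩
  (a ∘ suc ⊛ b ⊛ c) n + (a ⊛ b ∘ suc ⊛ c) n + (a ⊛ b ⊛ c ∘ suc) n
    ≡⟨ cong₂ _+_ (cong₂ _+_ (⊛-assoc (a ∘ suc) b c n) (⊛-assoc a (b ∘ suc) c n)) (⊛-assoc a b (c ∘ suc) n) ⟩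
  (a ∘ suc ⊛ (b ⊛ c)) n + (a ⊛ (b ∘ suc ⊛ c)) n + (a ⊛ (b ⊛ c ∘ suc)) n
    ≡⟨ +-assoc ((a ∘ suc ⊛ (b ⊛ c)) n) _ _ ⟩
  (a ∘ suc ⊛ (b ⊛ c)) n + ((a ⊛ (b ∘ suc ⊛ c)) n + (a ⊛ (b ⊛ c ∘ suc)) n)
    ≡⟨ cong (_+_ ((a ∘ suc ⊛ (b ⊛ c)) n)) (⊛-distribˡ-+ a (b ∘ suc ⊛ c) (b ⊛ c ∘ suc) n) ⟨
  (a ∘ suc ⊛ (b ⊛ c)) n + (a ⊛ (b ⊛ c) ∘ suc) n
    ∎

⊛-*ˡ : ∀ x a b → (λ n → x * a n) ⊛ b ≗ λ n → x * (a ⊛ b) n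
⊛-*ˡ x a b zero    = *-assoc x (a 0) (b 0)
⊛-*ˡ x a b (suc n) = trans (cong₂ _+_ (⊛-*ˡ x (a ∘ suc) b n) (⊛-*ˡ x a (b ∘ suc) n))
  (sym (*-distribˡ-+ x _ _))

⊛-*ʳ : ∀ x a b → a ⊛ (λ n → x * b n) ≗ λ n → x * (a ⊛ b) n
⊛-*ʳ x a b zero    = solve 3 (λ s t u → s :* (t :* u) := t :* (s :* u)) refl (a 0) x (b 0)
⊛-*ʳ x a b (suc n) = trans (cong₂ _+_ (⊛-*ʳ x (a ∘ suc) b n) (⊛-*ʳ x a (b ∘ suc) n))
  (sym (*-distribˡ-+ x _ _))

-- Substituting xt for t commutes with products of generating functions.
⊛-rescale : ∀ x a b → (λ n → a n * x ^ n) ⊛ (λ n → b n * x ^ n) ≗ λ n → (a ⊛ b) n * x ^ n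
⊛-rescale x a b zero    = solve 2 (λ s t → (s :* con 1ℚ) :* (t :* con 1ℚ) := (s :* t) :* con 1ℚ) refl (a 0) (b 0)
⊛-rescale x a b (suc n) = begin
  ((λ k → a (suc k) * (x * x ^ k)) ⊛ B) n + (A ⊛ (λ k → b (suc k) * (x * x ^ k))) n
    ≡⟨ cong₂ _+_ (⊛-congʳ (λ k → swap (a (suc k)) (x ^ k)) n) (⊛-congˡ {A} (λ k → swap (b (suc k)) (x ^ k)) n) ⟩
  ((λ k → x * A′ k) ⊛ B) n + (A ⊛ (λ k → x * B′ k)) n
    ≡⟨ cong₂ _+_ (⊛-*ˡ x A′ B n) (⊛-*ʳ x A B′ n) ⟩
  x * (A′ ⊛ B) n + x * (A ⊛ B′) n
    ≡⟨ cong₂ (λ u v → x * u + x * v) (⊛-rescale x (a ∘ suc) b n) (⊛-rescale x a (b ∘ suc) n) ⟩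
  x * ((a ∘ suc ⊛ b) n * x ^ n) + x * ((a ⊛ b ∘ suc) n * x ^ n)
    ≡⟨ solve 4 (λ x u v w → x :* (u :* w) :+ x :* (v :* w) := (u :+ v) :* (x :* w)) refl
         x ((a ∘ suc ⊛ b) n) ((a ⊛ b ∘ suc) n) (x ^ n) ⟩
  (a ⊛ b) (suc n) * x ^ suc n
    ∎
  where
  A B A′ B′ : ℕ → ℚ
  A  k = a k * x ^ k
  B  k = b k * x ^ k
  A′ k = a (suc k) * x ^ k
  B′ k = b (suc k) * x ^ k
  swap : ∀ u w → u * (x * w) ≡ x * (u * w)
  swap u w = solve 3 (λ x u w → u :* (x :* w) := x :* (u :* w)) refl x u w

-- The binomial theorem in the form e^(xt) e^(yt) = e^((x+y)t).
^-⊛-^ : ∀ x y → (x ^_) ⊛ (y ^_) ≗ (x + y) ^_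
^-⊛-^ x y zero    = refl
^-⊛-^ x y (suc n) = begin
  ((λ k → x * x ^ k) ⊛ (y ^_)) n + ((x ^_) ⊛ (λ k → y * y ^ k)) n
    ≡⟨ cong₂ _+_ (⊛-*ˡ x (x ^_) (y ^_) n) (⊛-*ʳ y (x ^_) (y ^_) n) ⟩
  x * ((x ^_) ⊛ (y ^_)) n + y * ((x ^_) ⊛ (y ^_)) n
    ≡⟨ *-distribʳ-+ _ x y ⟨
  (x + y) * ((x ^_) ⊛ (y ^_)) n
    ≡⟨ cong ((x + y) *_) (^-⊛-^ x y n) ⟩
  (x + y) ^ suc n ∎

1^n≡1 : ∀ n → 1ℚ ^ n ≡ 1ℚ
1^n≡1 zero    = refl
1^n≡1 (suc n) = trans (*-identityˡ (1ℚ ^ n)) (1^n≡1 n)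

-- The generating functions 0, 1 and t.
0ˢ 1ˢ X : ℕ → ℚ
0ˢ _ = 0ℚ
1ˢ zero    = 1ℚ
1ˢ (suc _) = 0ℚ
X zero    = 0ℚ
X (suc n) = 1ˢ n

⊛-zeroˡ : ∀ a → 0ˢ ⊛ a ≗ 0ˢ
⊛-zeroˡ a zero    = *-zeroˡ (a 0)
⊛-zeroˡ a (suc n) = cong₂ _+_ (⊛-zeroˡ a n) (⊛-zeroˡ (a ∘ suc) n)

⊛-identityˡ : ∀ a → 1ˢ ⊛ a ≗ a
⊛-identityˡ a zero    = *-identityˡ (a 0)
⊛-identityˡ a (suc n) = trans (cong₂ _+_ (⊛-zeroˡ a n) (⊛-identityˡ (a ∘ suc) n)) (+-identityˡ (a (suc n)))

-- The unit has the form e^(0t), with 0^0 = 1, because `shift-to-0` meets it as the powers of -½ +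
-- ½.
⊛-identityʳ : ∀ a → a ⊛ (0ℚ ^_) ≗ a
⊛-identityʳ a zero    = *-identityʳ (a 0)
⊛-identityʳ a (suc n) = begin
  (a ∘ suc ⊛ (0ℚ ^_)) n + (a ⊛ (λ k → 0ℚ * 0ℚ ^ k)) n
    ≡⟨ cong₂ _+_ (⊛-identityʳ (a ∘ suc) n) (⊛-*ʳ 0ℚ a (0ℚ ^_) n) ⟩
  a (suc n) + 0ℚ * (a ⊛ (0ℚ ^_)) n
    ≡⟨ solve 2 (λ u v → u :+ con 0ℚ :* v := u) refl (a (suc n)) ((a ⊛ (0ℚ ^_)) n) ⟩
  a (suc n) ∎

X-⊛ : ∀ a n → (X ⊛ a) (suc n) ≡ fromℕ (suc n) * a n
X-⊛ a zero    = solve 2 (λ u v → con 1ℚ :* u :+ con 0ℚ :* v := con 1ℚ :* u) refl (a 0) (a 1)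
X-⊛ a (suc n) = begin
  (1ˢ ⊛ a) (suc n) + (X ⊛ a ∘ suc) (suc n)  ≡⟨ cong₂ _+_ (⊛-identityˡ a (suc n)) (X-⊛ (a ∘ suc) n) ⟩
  a (suc n) + fromℕ (suc n) * a (suc n)     ≡⟨ solve 2 (λ u v → u :+ v :* u := (con 1ℚ :+ v) :* u) refl (a (suc n)) (fromℕ (suc n)) ⟩
  (1ℚ + fromℕ (suc n)) * a (suc n)          ≡⟨ cong (_* a (suc n)) (fromℕ-suc (suc n)) ⟨
  fromℕ (suc (suc n)) * a (suc n)           ∎

-- Binomial coefficients.

binom : ℕ → ℕ → ℚ
binom n k = fromℕ (n C k)

binom-0 : ∀ n → binom n 0 ≡ 1ℚ
binom-0 n = cong fromℕ (trans (nCk≡nC[n∸k] {0} {n} z≤n) (nCn≡1 n))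

binom-n : ∀ n → binom n n ≡ 1ℚ
binom-n n = cong fromℕ (nCn≡1 n)

binom-pascal : ∀ n k → binom n k + binom n (suc k) ≡ binom (suc n) (suc k)
binom-pascal n k = trans (sym (fromℕ-homo-+ (n C k) (n C suc k))) (cong fromℕ (nCk+nC[k+1]≡[n+1]C[k+1] n k))

binom-absorb : ∀ n k → fromℕ (suc k) * binom (suc n) (suc k) ≡ fromℕ (suc n) * binom n k
binom-absorb zero zero    = refl
binom-absorb zero (suc k) = *-zeroʳ (fromℕ (suc (suc k)))
binom-absorb (suc n) zero = begin
  1ℚ * binom (suc (suc n)) 1                ≡⟨ cong (1ℚ *_) (binom-pascal (suc n) 0) ⟨
  1ℚ * (binom (suc n) 0 + binom (suc n) 1)  ≡⟨ *-distribˡ-+ 1ℚ (binom (suc n) 0) (binom (suc n) 1) ⟩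
  1ℚ * binom (suc n) 0 + 1ℚ * binom (suc n) 1 ≡⟨ cong₂ _+_ (cong (1ℚ *_) (binom-0 (suc n))) (trans (binom-absorb n 0) (cong (fromℕ (suc n) *_) (binom-0 n))) ⟩
  1ℚ * 1ℚ + fromℕ (suc n) * 1ℚ ≡⟨ solve 1 (λ u → con 1ℚ :* con 1ℚ :+ u :* con 1ℚ := (con 1ℚ :+ u) :* con 1ℚ) refl (fromℕ (suc n)) ⟩
  (1ℚ + fromℕ (suc n)) * 1ℚ ≡⟨ cong₂ _*_ (fromℕ-suc (suc n)) (binom-0 (suc n)) ⟨
  fromℕ (suc (suc n)) * binom (suc n) 0 ∎
binom-absorb (suc n) (suc k) = begin
  fromℕ (2 ℕ.+ k) * binom (2 ℕ.+ n) (2 ℕ.+ k)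
    ≡⟨ cong (fromℕ (2 ℕ.+ k) *_) (binom-pascal (suc n) (suc k)) ⟨
  fromℕ (2 ℕ.+ k) * (c + c′)
    ≡⟨ *-distribˡ-+ (fromℕ (2 ℕ.+ k)) c c′ ⟩
  fromℕ (2 ℕ.+ k) * c + fromℕ (2 ℕ.+ k) * c′
    ≡⟨ cong₂ (λ u v → u * c + v) (fromℕ-suc (suc k)) (binom-absorb n (suc k)) ⟩
  (1ℚ + fromℕ (suc k)) * c + fromℕ (suc n) * binom n (suc k)
    ≡⟨ solve 4 (λ s c u v → (con 1ℚ :+ s) :* c :+ u :* v := c :+ (s :* c :+ u :* v)) refl (fromℕ (suc k)) c (fromℕ (suc n)) (binom n (suc k)) ⟩
  c + (fromℕ (suc k) * c + fromℕ (suc n) * binom n (suc k))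
    ≡⟨ cong (λ u → c + (u + fromℕ (suc n) * binom n (suc k))) (binom-absorb n k) ⟩
  c + (fromℕ (suc n) * binom n k + fromℕ (suc n) * binom n (suc k))
    ≡⟨ cong (_+_ c) (*-distribˡ-+ (fromℕ (suc n)) (binom n k) (binom n (suc k))) ⟨
  c + fromℕ (suc n) * (binom n k + binom n (suc k))
    ≡⟨ cong (λ u → c + fromℕ (suc n) * u) (binom-pascal n k) ⟩
  c + fromℕ (suc n) * c
    ≡⟨ solve 2 (λ c u → c :+ u :* c := (con 1ℚ :+ u) :* c) refl c (fromℕ (suc n)) ⟩
  (1ℚ + fromℕ (suc n)) * c
    ≡⟨ cong (_* c) (fromℕ-suc (suc n)) ⟨
  fromℕ (2 ℕ.+ n) * c
    ∎
  where
  c c′ : ℚ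
  c  = binom (suc n) (suc k)
  c′ = binom (suc n) (suc (suc k))

-- Multiplication by e^t, turned from the Leibniz form into an explicit binomial sum by Pascal's
-- rule.
⊛-ones : ∀ a n → (a ⊛ (1ℚ ^_)) n ≡ ∑ (suc n) (λ k → binom n k * a k)
⊛-ones a zero    = solve 1 (λ u → u :* con 1ℚ := con 1ℚ :* u :+ con 0ℚ) refl (a 0)
⊛-ones a (suc n) = begin
  (a ∘ suc ⊛ (1ℚ ^_)) n + (a ⊛ (λ k → 1ℚ * 1ℚ ^ k)) n
    ≡⟨ cong (_+_ ((a ∘ suc ⊛ (1ℚ ^_)) n)) (⊛-congˡ {a} (λ k → *-identityˡ (1ℚ ^ k)) n) ⟩
  (a ∘ suc ⊛ (1ℚ ^_)) n + (a ⊛ (1ℚ ^_)) n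
    ≡⟨ cong₂ _+_ (⊛-ones (a ∘ suc) n) (⊛-ones a n) ⟩
  S + ∑ (suc n) f
    -- The vanishing term k = n+1 is appended, so that splitting off k = 0 leaves two sums of equal
    -- length.
    ≡⟨ cong (_+_ S) (+-identityʳ (∑ (suc n) f)) ⟨
  S + (∑ (suc n) f + 0ℚ)
    ≡⟨ cong (λ u → S + (∑ (suc n) f + u)) f[n+1]≡0 ⟨
  S + (∑ (suc n) f + f (suc n))
    ≡⟨ cong (_+_ S) (∑-last (suc n) f) ⟨
  S + (f 0 + ∑ (suc n) (f ∘ suc))
    ≡⟨ solve 3 (λ s u t → s :+ (u :+ t) := u :+ (s :+ t)) refl S (f 0) (∑ (suc n) (f ∘ suc)) ⟩
  f 0 + (S + ∑ (suc n) (f ∘ suc))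
    ≡⟨ cong₂ _+_ (cong (_* a 0) (trans (binom-0 n) (sym (binom-0 (suc n))))) (sym (∑-+ (suc n) (λ k → binom n k * a (suc k)) (f ∘ suc))) ⟩
  binom (suc n) 0 * a 0 + ∑ (suc n) (λ k → binom n k * a (suc k) + binom n (suc k) * a (suc k))
    ≡⟨ cong (_+_ (binom (suc n) 0 * a 0)) (∑-cong (suc n) (λ k →
         trans (sym (*-distribʳ-+ (a (suc k)) (binom n k) (binom n (suc k)))) (cong (_* a (suc k)) (binom-pascal n k)))) ⟩
  ∑ (suc (suc n)) (λ k → binom (suc n) k * a k)
    ∎
  where
  f : ℕ → ℚ
  f k = binom n k * a k
  S : ℚ
  S = ∑ (suc n) (λ k → binom n k * a (suc k))
  f[n+1]≡0 : f (suc n) ≡ 0ℚ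
  f[n+1]≡0 = trans (cong (λ u → fromℕ u * a (suc n)) (k>n⇒nCk≡0 (ℕ.n<1+n n))) (*-zeroˡ (a (suc n)))

-- Bernoulli numbers and their generating function.

bernRev-applyDownFrom : ∀ n → bernRev n ≡ applyDownFrom bernoulli n
bernRev-applyDownFrom zero          = refl
bernRev-applyDownFrom (suc zero)    = refl
bernRev-applyDownFrom (suc (suc n)) = cong (bernoulli (suc n) ∷_) (bernRev-applyDownFrom (suc n))

zipWith-applyUpTo : ∀ {A B C : Set} (g : A → B → C) f₁ f₂ n →
  zipWith g (applyUpTo f₁ n) (applyUpTo f₂ n) ≡ applyUpTo (λ k → g (f₁ k) (f₂ k)) n
zipWith-applyUpTo g f₁ f₂ zero    = refl
zipWith-applyUpTo g f₁ f₂ (suc n) = cong (g (f₁ 0) (f₂ 0) ∷_) (zipWith-applyUpTo g (f₁ ∘ suc) (f₂ ∘ suc) n)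

bernoulli-suc : ∀ n → bernoulli (suc n) ≡
  - ((+ 1 / suc (suc n)) * ∑ (suc n) (λ k → binom (suc (suc n)) k * bernoulli k))
bernoulli-suc n = cong (λ l → - ((+ 1 / suc (suc n)) * sumℚ l)) (begin
  zipWith g (upTo (suc n)) (reverse (bernRev (suc n)))
    ≡⟨ cong (zipWith g (upTo (suc n)) ∘ reverse) (bernRev-applyDownFrom (suc n)) ⟩
  zipWith g (upTo (suc n)) (reverse (applyDownFrom bernoulli (suc n)))
    ≡⟨ cong (zipWith g (upTo (suc n))) (reverse-applyDownFrom bernoulli (suc n)) ⟩
  zipWith g (upTo (suc n)) (applyUpTo bernoulli (suc n))
    ≡⟨ zipWith-applyUpTo g id bernoulli (suc n) ⟩
  applyUpTo (λ k → g k (bernoulli k)) (suc n) ∎)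
  where
  g : ℕ → ℚ → ℚ
  g k b = binom (suc (suc n)) k * b

binom-n+1-n : ∀ n → binom (suc n) n ≡ fromℕ (suc n)
binom-n+1-n zero    = refl
binom-n+1-n (suc n) = begin
  binom (suc (suc n)) (suc n)            ≡⟨ binom-pascal (suc n) n ⟨
  binom (suc n) n + binom (suc n) (suc n) ≡⟨ cong₂ _+_ (binom-n+1-n n) (binom-n (suc n)) ⟩
  fromℕ (suc n) + 1ℚ                     ≡⟨ +-comm (fromℕ (suc n)) 1ℚ ⟩
  1ℚ + fromℕ (suc n)                     ≡⟨ fromℕ-suc (suc n) ⟨
  fromℕ (suc (suc n))                    ∎

-- The last term has weight C(n+2,n+1) = n+2, which cancels the division by n+2 in the recurrence.
∑-bernoulli : ∀ n → ∑ (suc (suc n)) (λ k → binom (suc (suc n)) k * bernoulli k) ≡ 0ℚ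
∑-bernoulli n = begin
  ∑ (suc (suc n)) f          ≡⟨ ∑-last (suc n) f ⟩
  S + f (suc n)              ≡⟨ cong (_+_ S) (cong₂ _*_ (binom-n+1-n (suc n)) (bernoulli-suc n)) ⟩
  S + N * - (N⁻¹ * S)        ≡⟨ solve 3 (λ s u v → s :+ u :* (:- (v :* s)) := s :+ (:- ((u :* v) :* s))) refl S N N⁻¹ ⟩
  S + - (N * N⁻¹ * S)        ≡⟨ cong (λ u → S + - (u * S)) (*-inverse-fromℕ (suc n)) ⟩
  S + - (1ℚ * S)             ≡⟨ solve 1 (λ s → s :+ (:- (con 1ℚ :* s)) := con 0ℚ) refl S ⟩
  0ℚ                         ∎
  where
  f : ℕ → ℚ
  f k = binom (suc (suc n)) k * bernoulli k
  S N N⁻¹ : ℚ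
  S = ∑ (suc n) f
  N = fromℕ (suc (suc n))
  N⁻¹ = + 1 / suc (suc n)

-- This is B(t) e^t = B(t) + t, that is, B(t) = t/(e^t - 1). The term t matters only at index 1.
bernoulli-⊛-ones : bernoulli ⊛ (1ℚ ^_) ≗ λ n → bernoulli n + X n
bernoulli-⊛-ones zero          = refl
bernoulli-⊛-ones (suc zero)    = refl
bernoulli-⊛-ones (suc (suc n)) = begin
  (bernoulli ⊛ (1ℚ ^_)) (2 ℕ.+ n)  ≡⟨ ⊛-ones bernoulli (2 ℕ.+ n) ⟩
  ∑ (3 ℕ.+ n) f                    ≡⟨ ∑-last (2 ℕ.+ n) f ⟩
  ∑ (2 ℕ.+ n) f + f (2 ℕ.+ n)      ≡⟨ cong₂ _+_ (∑-bernoulli n) (cong (_* bernoulli (2 ℕ.+ n)) (binom-n (2 ℕ.+ n))) ⟩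
  0ℚ + 1ℚ * bernoulli (2 ℕ.+ n)    ≡⟨ solve 1 (λ u → con 0ℚ :+ con 1ℚ :* u := u :+ con 0ℚ) refl (bernoulli (2 ℕ.+ n)) ⟩
  bernoulli (2 ℕ.+ n) + 0ℚ         ∎
  where
  f : ℕ → ℚ
  f k = binom (2 ℕ.+ n) k * bernoulli k

-- Evaluation of a Bernoulli sum at -½.

bernoulli-½ : ℕ → ℚ
bernoulli-½ n = bernoulli n * -½ ^ n

-- With F(t) = B(-t/2), rescaling the previous identity gives F(t) e^(-t/2) = F(t) - t/2;
-- multiplying by e^(xt) moves x by -½.
bernoulli-½-⊛-shift : ∀ x n →
  (bernoulli-½ ⊛ (x ^_)) n + -½ * (X ⊛ (x ^_)) n ≡ (bernoulli-½ ⊛ ((-½ + x) ^_)) n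
bernoulli-½-⊛-shift x n = sym (begin
  (bernoulli-½ ⊛ ((-½ + x) ^_)) n            ≡⟨ ⊛-congˡ {bernoulli-½} (^-⊛-^ -½ x) n ⟨
  (bernoulli-½ ⊛ ((-½ ^_) ⊛ (x ^_))) n       ≡⟨ ⊛-assoc bernoulli-½ (-½ ^_) (x ^_) n ⟨
  (bernoulli-½ ⊛ (-½ ^_) ⊛ (x ^_)) n         ≡⟨ ⊛-congʳ step n ⟩
  ((λ k → bernoulli-½ k + -½ * X k) ⊛ (x ^_)) n
    ≡⟨ ⊛-distribʳ-+ (x ^_) bernoulli-½ (λ k → -½ * X k) n ⟩
  (bernoulli-½ ⊛ (x ^_)) n + ((λ k → -½ * X k) ⊛ (x ^_)) n
    ≡⟨ cong (_+_ ((bernoulli-½ ⊛ (x ^_)) n)) (⊛-*ˡ -½ X (x ^_) n) ⟩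
  (bernoulli-½ ⊛ (x ^_)) n + -½ * (X ⊛ (x ^_)) n ∎)
  where
  X-scale : ∀ k → X k * -½ ^ k ≡ -½ * X k
  X-scale zero          = refl
  X-scale (suc zero)    = refl
  X-scale (suc (suc k)) = *-zeroˡ (-½ ^ suc (suc k))

  step : bernoulli-½ ⊛ (-½ ^_) ≗ λ k → bernoulli-½ k + -½ * X k
  step k = begin
    (bernoulli-½ ⊛ (-½ ^_)) k
      -- The factor 1^j makes both operands rescaled sequences, as `⊛-rescale` requires.
      ≡⟨ ⊛-congˡ {bernoulli-½} (λ j → trans (sym (*-identityˡ (-½ ^ j))) (cong (_* -½ ^ j) (sym (1^n≡1 j)))) k ⟩
    (bernoulli-½ ⊛ (λ j → 1ℚ ^ j * -½ ^ j)) k  ≡⟨ ⊛-rescale -½ bernoulli (1ℚ ^_) k ⟩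
    (bernoulli ⊛ (1ℚ ^_)) k * -½ ^ k            ≡⟨ cong (_* -½ ^ k) (bernoulli-⊛-ones k) ⟩
    (bernoulli k + X k) * -½ ^ k                ≡⟨ *-distribʳ-+ (-½ ^ k) (bernoulli k) (X k) ⟩
    bernoulli-½ k + X k * -½ ^ k                ≡⟨ cong (_+_ (bernoulli-½ k)) (X-scale k) ⟩
    bernoulli-½ k + -½ * X k                    ∎

-- Two shifts lead from x = 1 through ½ to 0. At x = 1 the coefficient is the sum plus `b`, at x = 0
-- it is `b` alone; the difference comes from the two `X` terms.
∑-bernoulli-½ : ∀ n → ∑ (suc n) (λ k → binom (suc n) k * bernoulli-½ k) ≡ fromℕ (suc n) * (½ * (1ℚ + ½ ^ n))
∑-bernoulli-½ n = begin
  S                                       ≡⟨ solve 2 (λ s b → s := (s :+ con 1ℚ :* b) :+ (:- b)) refl S b ⟩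
  S + 1ℚ * b + - b                        ≡⟨ cong₂ (λ u v → S + u * b + - v) (binom-n (suc n)) shift-to-0 ⟨
  S + f (suc n) + - (U + -½ * (X ⊛ (½ ^_)) (suc n))
    ≡⟨ cong₂ (λ u v → u + - (v + -½ * (X ⊛ (½ ^_)) (suc n))) (trans (⊛-ones bernoulli-½ (suc n)) (∑-last (suc n) f)) (bernoulli-½-⊛-shift 1ℚ (suc n)) ⟨
  V + - (V + -½ * (X ⊛ (1ℚ ^_)) (suc n) + -½ * (X ⊛ (½ ^_)) (suc n))
    ≡⟨ cong₂ (λ u v → V + - (V + -½ * u + -½ * v)) (trans (X-⊛ (1ℚ ^_) n) (cong (fromℕ (suc n) *_) (1^n≡1 n))) (X-⊛ (½ ^_) n) ⟩
  V + - (V + -½ * (fromℕ (suc n) * 1ℚ) + -½ * (fromℕ (suc n) * ½ ^ n))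
    ≡⟨ solve 3 (λ v p h → v :+ (:- (v :+ con -½ :* (p :* con 1ℚ) :+ con -½ :* (p :* h))) := p :* (con ½ :* (con 1ℚ :+ h)))
         refl V (fromℕ (suc n)) (½ ^ n) ⟩
  fromℕ (suc n) * (½ * (1ℚ + ½ ^ n)) ∎
  where
  f : ℕ → ℚ
  f k = binom (suc n) k * bernoulli-½ k
  S U V b : ℚ
  S = ∑ (suc n) f
  b = bernoulli-½ (suc n)
  U = (bernoulli-½ ⊛ (½ ^_)) (suc n)
  V = (bernoulli-½ ⊛ (1ℚ ^_)) (suc n)
  shift-to-0 : U + -½ * (X ⊛ (½ ^_)) (suc n) ≡ b
  shift-to-0 = trans (bernoulli-½-⊛-shift ½ (suc n)) (⊛-identityʳ bernoulli-½ (suc n))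

-- The index is shifted: `B/ k` is `calB p (suc k)`, for every p.
B/ : ℕ → ℚ
B/ k = bernoulli (suc k) * (+ 1 / suc k)

-- Used twice: to turn B_k into B_k/k, and for n+1 = p to extract a factor p from a binomial
-- coefficient.
binom-div : ∀ n k → binom (suc n) (suc k) ≡ fromℕ (suc n) * (binom n k * (+ 1 / suc k))
binom-div n k = begin
  c                            ≡⟨ *-identityˡ c ⟨
  1ℚ * c                       ≡⟨ cong (_* c) (*-inverse-fromℕ k) ⟨
  K * K⁻¹ * c                  ≡⟨ solve 3 (λ u v w → u :* v :* w := u :* w :* v) refl K K⁻¹ c ⟩
  K * c * K⁻¹                  ≡⟨ cong (_* K⁻¹) (binom-absorb n k) ⟩
  fromℕ (suc n) * binom n k * K⁻¹ ≡⟨ *-assoc (fromℕ (suc n)) (binom n k) K⁻¹ ⟩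
  fromℕ (suc n) * (binom n k * K⁻¹) ∎
  where
  c K K⁻¹ : ℚ
  c = binom (suc n) (suc k)
  K = fromℕ (suc k)
  K⁻¹ = + 1 / suc k

-- `∑-bernoulli-½` divided by n+1. The k = 0 term becomes 1/(n+1), which for n+1 = p is the negative
-- of `calB p 0`.
∑-B/ : ∀ n → (+ 1 / suc n) + ∑ n (λ k → binom n k * B/ k * -½ ^ suc k) ≡ ½ * (1ℚ + ½ ^ n)
∑-B/ n = begin
  P⁻¹ + S                          ≡⟨ solve 2 (λ u s → u :+ s := u :* con 1ℚ :+ con 1ℚ :* s) refl P⁻¹ S ⟩
  P⁻¹ * 1ℚ + 1ℚ * S                ≡⟨ cong (λ u → P⁻¹ * 1ℚ + u * S) (*-inverse-fromℕ n) ⟨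
  P⁻¹ * 1ℚ + P * P⁻¹ * S           ≡⟨ solve 3 (λ p q s → q :* con 1ℚ :+ p :* q :* s := q :* (con 1ℚ :* con 1ℚ :+ p :* s)) refl P P⁻¹ S ⟩
  P⁻¹ * (1ℚ * 1ℚ + P * S)          ≡⟨ cong₂ (λ u v → P⁻¹ * (u * 1ℚ + v)) (sym (binom-0 (suc n))) (sym (trans (∑-cong n term) (∑-*ˡ n P (λ k → binom n k * B/ k * -½ ^ suc k)))) ⟩
  P⁻¹ * ∑ (suc n) f                ≡⟨ cong (P⁻¹ *_) (∑-bernoulli-½ n) ⟩
  P⁻¹ * (P * (½ * (1ℚ + ½ ^ n)))   ≡⟨ solve 3 (λ p q s → q :* (p :* s) := (p :* q) :* s) refl P P⁻¹ (½ * (1ℚ + ½ ^ n)) ⟩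
  P * P⁻¹ * (½ * (1ℚ + ½ ^ n))     ≡⟨ cong (_* (½ * (1ℚ + ½ ^ n))) (*-inverse-fromℕ n) ⟩
  1ℚ * (½ * (1ℚ + ½ ^ n))          ≡⟨ *-identityˡ (½ * (1ℚ + ½ ^ n)) ⟩
  ½ * (1ℚ + ½ ^ n)                 ∎
  where
  f : ℕ → ℚ
  f k = binom (suc n) k * bernoulli-½ k
  P P⁻¹ S : ℚ
  P = fromℕ (suc n)
  P⁻¹ = + 1 / suc n
  S = ∑ n (λ k → binom n k * B/ k * -½ ^ suc k)
  term : ∀ k → f (suc k) ≡ P * (binom n k * B/ k * -½ ^ suc k)
  term k = trans (cong (_* bernoulli-½ (suc k)) (binom-div n k))
    (solve 5 (λ p c r b y → p :* (c :* r) :* (b :* y) := p :* (c :* (b :* r) :* y)) refl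
      P (binom n k) (+ 1 / suc k) (bernoulli (suc k)) (-½ ^ suc k))

-- Parity of n, phrased for n = p-1: the second case would make p even.
-½^n≡½^n⊎2∣1+n : ∀ n → -½ ^ n ≡ ½ ^ n ⊎ 2 ∣ suc n
-½^n≡½^n⊎2∣1+n zero          = inj₁ refl
-½^n≡½^n⊎2∣1+n (suc zero)    = inj₂ ∣-refl
-½^n≡½^n⊎2∣1+n (suc (suc n)) with -½^n≡½^n⊎2∣1+n n
... | inj₁ eq  = inj₁ (trans (solve 1 (λ y → con -½ :* (con -½ :* y) := con ½ :* (con ½ :* y)) refl (-½ ^ n)) (cong (λ y → ½ * (½ * y)) eq))
... | inj₂ 2∣n = inj₂ (∣m∣n⇒∣m+n ∣-refl 2∣n)

½^n*2^n≡1 : ∀ n → ½ ^ n * (1ℚ + 1ℚ) ^ n ≡ 1ℚ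
½^n*2^n≡1 zero    = refl
½^n*2^n≡1 (suc n) = trans
  (solve 2 (λ h t → con ½ :* h :* (con (1ℚ + 1ℚ) :* t) := h :* t) refl (½ ^ n) ((1ℚ + 1ℚ) ^ n)) (½^n*2^n≡1 n)

-- Rational p-adic integers and multiples of p.

module PAdic {p : ℕ} (p-prime : Prime p) where

  infix 4 _∈Zp _∈pZp

  -- The fraction need not be in lowest terms, so closure under sums and products follows from
  -- Euclid's lemma alone. The condition `p ∤ d` also excludes d = 0.
  data _∈Zp (q : ℚ) : Set where
    fraction : ∀ d a → p ∤ d → q * fromℕ d ≡ fromℤ a → q ∈Zp

  data _∈pZp (q : ℚ) : Set where
    multiple : ∀ r → r ∈Zp → q ≡ fromℕ p * r → q ∈pZp

  p∤1 : p ∤ 1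
  p∤1 = >⇒∤ (ℕ.nonTrivial⇒n>1 p {{prime⇒nonTrivial p-prime}})

  p∤* : ∀ {d e} → p ∤ d → p ∤ e → p ∤ d ℕ.* e
  p∤* {d} {e} p∤d p∤e p∣de = [ p∤d , p∤e ]′ (euclidsLemma d e p-prime p∣de)

  fromℤ-∈Zp : ∀ a → fromℤ a ∈Zp
  fromℤ-∈Zp a = fraction 1 a p∤1 (*-identityʳ (fromℤ a))

  fromℕ-∈Zp : ∀ n → fromℕ n ∈Zp
  fromℕ-∈Zp n = fromℤ-∈Zp (+ n)

  +-∈Zp : ∀ {q r} → q ∈Zp → r ∈Zp → q + r ∈Zp
  +-∈Zp {q} {r} (fraction d a p∤d qd≡a) (fraction e b p∤e re≡b) =
    fraction (d ℕ.* e) (a ℤ.* + e ℤ.+ b ℤ.* + d) (p∤* p∤d p∤e) (begin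
      (q + r) * fromℕ (d ℕ.* e)                         ≡⟨ cong ((q + r) *_) (fromℕ-homo-* d e) ⟩
      (q + r) * (fromℕ d * fromℕ e)
        ≡⟨ solve 4 (λ q r d e → (q :+ r) :* (d :* e) := (q :* d) :* e :+ (r :* e) :* d) refl q r (fromℕ d) (fromℕ e) ⟩
      q * fromℕ d * fromℕ e + r * fromℕ e * fromℕ d    ≡⟨ cong₂ (λ u v → u * fromℕ e + v * fromℕ d) qd≡a re≡b ⟩
      fromℤ a * fromℕ e + fromℤ b * fromℕ d            ≡⟨ cong₂ _+_ (fromℤ-homo-* a (+ e)) (fromℤ-homo-* b (+ d)) ⟨
      fromℤ (a ℤ.* + e) + fromℤ (b ℤ.* + d)            ≡⟨ fromℤ-homo-+ (a ℤ.* + e) (b ℤ.* + d) ⟨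
      fromℤ (a ℤ.* + e ℤ.+ b ℤ.* + d)                  ∎)

  *-∈Zp : ∀ {q r} → q ∈Zp → r ∈Zp → q * r ∈Zp
  *-∈Zp {q} {r} (fraction d a p∤d qd≡a) (fraction e b p∤e re≡b) =
    fraction (d ℕ.* e) (a ℤ.* b) (p∤* p∤d p∤e) (begin
      q * r * fromℕ (d ℕ.* e)          ≡⟨ cong (q * r *_) (fromℕ-homo-* d e) ⟩
      q * r * (fromℕ d * fromℕ e)
        ≡⟨ solve 4 (λ q r d e → q :* r :* (d :* e) := (q :* d) :* (r :* e)) refl q r (fromℕ d) (fromℕ e) ⟩
      q * fromℕ d * (r * fromℕ e)      ≡⟨ cong₂ _*_ qd≡a re≡b ⟩
      fromℤ a * fromℤ b                ≡⟨ fromℤ-homo-* a b ⟨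
      fromℤ (a ℤ.* b)                  ∎)

  neg-∈Zp : ∀ {q} → q ∈Zp → - q ∈Zp
  neg-∈Zp {q} q∈ = subst _∈Zp (neg-mul q) (*-∈Zp (fromℤ-∈Zp (ℤ.- + 1)) q∈)
    where
    neg-mul : ∀ q → (- 1ℚ) * q ≡ - q
    neg-mul = solve 1 (λ q → con (- 1ℚ) :* q := :- q) refl

  ^-∈Zp : ∀ {q} → q ∈Zp → ∀ n → q ^ n ∈Zp
  ^-∈Zp q∈ zero    = fromℕ-∈Zp 1
  ^-∈Zp q∈ (suc n) = *-∈Zp q∈ (^-∈Zp q∈ n)

  1/-∈Zp : ∀ n → p ∤ suc n → (+ 1 / suc n) ∈Zp
  1/-∈Zp n p∤ = fraction (suc n) (+ 1) p∤ (trans (*-comm (+ 1 / suc n) (fromℕ (suc n))) (*-inverse-fromℕ n))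

  1/-<-∈Zp : ∀ n → suc n ℕ.< p → (+ 1 / suc n) ∈Zp
  1/-<-∈Zp n n<p = 1/-∈Zp n (>⇒∤ n<p)

  ∈pZp⇒∈Zp : ∀ {q} → q ∈pZp → q ∈Zp
  ∈pZp⇒∈Zp (multiple r r∈ refl) = *-∈Zp (fromℕ-∈Zp p) r∈

  p*-∈pZp : ∀ {q} → q ∈Zp → fromℕ p * q ∈pZp
  p*-∈pZp {q} q∈ = multiple q q∈ refl

  0∈pZp : 0ℚ ∈pZp
  0∈pZp = multiple 0ℚ (fromℕ-∈Zp 0) (sym (*-zeroʳ (fromℕ p)))

  +-∈pZp : ∀ {q r} → q ∈pZp → r ∈pZp → q + r ∈pZp
  +-∈pZp (multiple q q∈ refl) (multiple r r∈ refl) = multiple (q + r) (+-∈Zp q∈ r∈) (sym (*-distribˡ-+ (fromℕ p) q r))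

  *-∈pZp : ∀ {q r} → q ∈Zp → r ∈pZp → q * r ∈pZp
  *-∈pZp {q} q∈ (multiple r r∈ refl) = multiple (q * r) (*-∈Zp q∈ r∈)
    (solve 3 (λ q p r → q :* (p :* r) := p :* (q :* r)) refl q (fromℕ p) r)

  neg-∈pZp : ∀ {q} → q ∈pZp → - q ∈pZp
  neg-∈pZp (multiple r r∈ refl) = multiple (- r) (neg-∈Zp r∈) (neg-distribʳ-* (fromℕ p) r)

  ∑-∈Zp : ∀ n {f} → (∀ {k} → k ℕ.< n → f k ∈Zp) → ∑ n f ∈Zp
  ∑-∈Zp zero    f∈ = fromℕ-∈Zp 0
  ∑-∈Zp (suc n) f∈ = +-∈Zp (f∈ (s≤s z≤n)) (∑-∈Zp n (f∈ ∘ s<s))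

  ∑-∈pZp : ∀ n {f} → (∀ {k} → k ℕ.< n → f k ∈pZp) → ∑ n f ∈pZp
  ∑-∈pZp zero    f∈ = 0∈pZp
  ∑-∈pZp (suc n) f∈ = +-∈pZp (f∈ (s≤s z≤n)) (∑-∈pZp n (f∈ ∘ s<s))

  -- Clearing denominators shows that p divides n·d, hence n, as p does not divide d. The
  -- lowest-terms denominator is coprime to n, so p cannot divide it.
  ∈pZp⇒InpZp : ∀ {q} → q ∈pZp → InpZp p q
  ∈pZp⇒InpZp {q@(mkℚ n d-1 c)} (multiple r (fraction d a p∤d rd≡a) q≡pr) =
    p∣n , λ p∣d → p∤1 (subst (p ∣_) (recompute c (p∣n , p∣d)) ∣-refl)
    where
    qd≡pa : q * fromℕ d ≡ fromℤ (+ p ℤ.* a)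
    qd≡pa = begin
      q * fromℕ d             ≡⟨ cong (_* fromℕ d) q≡pr ⟩
      fromℕ p * r * fromℕ d   ≡⟨ *-assoc (fromℕ p) r (fromℕ d) ⟩
      fromℕ p * (r * fromℕ d) ≡⟨ cong (fromℕ p *_) rd≡a ⟩
      fromℕ p * fromℤ a       ≡⟨ fromℤ-homo-* (+ p) a ⟨
      fromℤ (+ p ℤ.* a)       ∎
    qd≃pa : toℚᵘ q ℚᵘ.* (+ d ℚᵘ./ 1) ℚᵘ.≃ ((+ p ℤ.* a) ℚᵘ./ 1)
    qd≃pa = ℚᵘ.≃-trans (ℚᵘ.≃-sym (ℚᵘ.≃-trans (toℚᵘ-homo-* q (fromℕ d)) (ℚᵘ.*-congˡ {toℚᵘ q} (toℚᵘ-/ (+ d) 0))))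
      (ℚᵘ.≃-trans (ℚᵘ.≃-reflexive (cong toℚᵘ qd≡pa)) (toℚᵘ-/ (+ p ℤ.* a) 0))
    D : ℤ
    D = ℚᵘ.↧ (toℚᵘ q ℚᵘ.* (+ d ℚᵘ./ 1))
    nd≡paD : ℤ.∣ n ∣ ℕ.* d ≡ p ℕ.* ℤ.∣ a ∣ ℕ.* ℤ.∣ D ∣
    nd≡paD = begin
      ℤ.∣ n ∣ ℕ.* d                  ≡⟨ ℤ.abs-* n (+ d) ⟨
      ℤ.∣ n ℤ.* + d ∣                ≡⟨ cong ℤ.∣_∣ (trans (sym (ℤ.*-identityʳ (n ℤ.* + d))) (ℚᵘ.drop-*≡* qd≃pa)) ⟩
      ℤ.∣ + p ℤ.* a ℤ.* D ∣          ≡⟨ ℤ.abs-* (+ p ℤ.* a) D ⟩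
      ℤ.∣ + p ℤ.* a ∣ ℕ.* ℤ.∣ D ∣    ≡⟨ cong (ℕ._* ℤ.∣ D ∣) (ℤ.abs-* (+ p) a) ⟩
      p ℕ.* ℤ.∣ a ∣ ℕ.* ℤ.∣ D ∣      ∎
    p∣n : p ∣ ℤ.∣ n ∣
    p∣n = [ id , ⊥-elim ∘ p∤d ]′ (euclidsLemma ℤ.∣ n ∣ d p-prime
      (subst (p ∣_) (sym nd≡paD) (∣m⇒∣m*n ℤ.∣ D ∣ (∣m⇒∣m*n ℤ.∣ a ∣ ∣-refl))))

  -- The recurrence for B_n divides only by n+1 < p. Strong induction, with `below` covering all
  -- indices under a bound.
  bernoulli-∈Zp : ∀ n → suc n ℕ.< p → bernoulli n ∈Zp
  bernoulli-∈Zp n 1+n<p = below (suc n) 1+n<p (ℕ.n<1+n n)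
    where
    below : ∀ n → n ℕ.< p → ∀ {k} → k ℕ.< n → bernoulli k ∈Zp
    below (suc n) n<p {k} k<n with ℕ.m<1+n⇒m<n∨m≡n k<n
    ... | inj₁ k<n′ = below n (ℕ.<-trans (ℕ.n<1+n n) n<p) k<n′
    below (suc zero)    n<p k<n | inj₂ refl = fromℕ-∈Zp 1
    below (suc (suc n)) n<p k<n | inj₂ refl = subst _∈Zp (sym (bernoulli-suc n))
      (neg-∈Zp (*-∈Zp (1/-<-∈Zp (suc n) n<p) (∑-∈Zp (suc n) λ {k} k<1+n →
        *-∈Zp (fromℕ-∈Zp (suc (suc n) C k)) (below (suc n) (ℕ.<-trans (ℕ.n<1+n (suc n)) n<p) k<1+n))))

  ½-∈Zp : p ≢ 2 → ½ ∈Zp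
  ½-∈Zp p≢2 = 1/-∈Zp 1 λ p∣2 → [ (λ p≡1 → p∤1 (subst (p ∣_) p≡1 ∣-refl)) , p≢2 ]′ (irreducible[2] p∣2)

-- Binomial coefficients and powers of 2 modulo p = n+1.

module _ {n : ℕ} (p-prime : Prime (suc n)) where

  open PAdic p-prime

  private
    P : ℚ
    P = fromℕ (suc n)

  -- The cofactor of p contains 1/(k+1), which is p-integral because k+1 < p.
  binom-∈pZp : ∀ {k} → k ℕ.< n → binom (suc n) (suc k) ∈pZp
  binom-∈pZp {k} k<n = multiple (binom n k * (+ 1 / suc k))
    (*-∈Zp (fromℕ-∈Zp (n C k)) (1/-<-∈Zp k (s<s k<n))) (binom-div n k)

  -- In the expansion of (1+1)^p the two outer terms give 2 and p divides all others.
  fermat-2 : (1ℚ + 1ℚ) ^ suc n + - (1ℚ + 1ℚ) ∈pZp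
  fermat-2 = subst _∈pZp (sym (begin
    (1ℚ + 1ℚ) ^ suc n + - (1ℚ + 1ℚ)                   ≡⟨ cong (_+ - (1ℚ + 1ℚ)) (^-⊛-^ 1ℚ 1ℚ (suc n)) ⟨
    ((1ℚ ^_) ⊛ (1ℚ ^_)) (suc n) + - (1ℚ + 1ℚ)         ≡⟨ cong (_+ - (1ℚ + 1ℚ)) (trans (⊛-ones (1ℚ ^_) (suc n)) (∑-last (suc n) f)) ⟩
    f 0 + S + f (suc n) + - (1ℚ + 1ℚ)
      ≡⟨ cong₂ (λ u v → u * 1ℚ + S + v + - (1ℚ + 1ℚ)) (binom-0 (suc n)) (cong₂ _*_ (binom-n (suc n)) (1^n≡1 (suc n))) ⟩
    1ℚ * 1ℚ + S + 1ℚ * 1ℚ + - (1ℚ + 1ℚ)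
      ≡⟨ solve 1 (λ s → con 1ℚ :* con 1ℚ :+ s :+ con 1ℚ :* con 1ℚ :+ con (- (1ℚ + 1ℚ)) := s) refl S ⟩
    S                                                 ∎))
    (∑-∈pZp n λ {k} k<n → subst _∈pZp (sym (f[k] k)) (binom-∈pZp k<n))
    where
    f : ℕ → ℚ
    f k = binom (suc n) k * 1ℚ ^ k
    S : ℚ
    S = ∑ n (f ∘ suc)
    f[k] : ∀ k → f (suc k) ≡ binom (suc n) (suc k)
    f[k] k = trans (cong (binom (suc n) (suc k) *_) (1^n≡1 (suc k))) (*-identityʳ (binom (suc n) (suc k)))

  -- This is C(p-1,k) ≡ (-1)^k scaled by ½^k. By Pascal's rule consecutive coefficients add up to
  -- C(p,k+1) ≡ 0, so each step changes the sign.
  ½^k-binom*-½^k-∈pZp : ½ ∈Zp → ∀ {k} → k ℕ.≤ n → ½ ^ k + - (binom n k * -½ ^ k) ∈pZp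
  ½^k-binom*-½^k-∈pZp ½∈ {zero}  _   = subst _∈pZp (cong (λ u → 1ℚ + - (u * 1ℚ)) (sym (binom-0 n))) 0∈pZp
  ½^k-binom*-½^k-∈pZp ½∈ {suc k} k<n = subst _∈pZp (begin
    ½ * (½ ^ k + - (c * -½ ^ k)) + - (-½ ^ suc k * binom (suc n) (suc k))
      ≡⟨ cong (λ u → ½ * (½ ^ k + - (c * -½ ^ k)) + - (-½ ^ suc k * u)) (binom-pascal n k) ⟨
    ½ * (½ ^ k + - (c * -½ ^ k)) + - (-½ ^ suc k * (c + c′))
      ≡⟨ solve 4 (λ h y c c′ → con ½ :* (h :+ (:- (c :* y))) :+ (:- (con -½ :* y :* (c :+ c′))) :=
           con ½ :* h :+ (:- (c′ :* (con -½ :* y)))) refl (½ ^ k) (-½ ^ k) c c′ ⟩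
    ½ ^ suc k + - (c′ * -½ ^ suc k) ∎)
    (+-∈pZp (*-∈pZp ½∈ (½^k-binom*-½^k-∈pZp ½∈ (ℕ.<⇒≤ k<n)))
            (neg-∈pZp (*-∈pZp (^-∈Zp (neg-∈Zp ½∈) (suc k)) (binom-∈pZp k<n))))
    where
    c c′ : ℚ
    c  = binom n k
    c′ = binom n (suc k)

-- The congruence for p = m+2.

module _ {m : ℕ} (p-prime : Prime (suc (suc m))) (p≢2 : suc (suc m) ≢ 2) where

  open PAdic p-prime

  private
    n : ℕ
    n = suc m
    -- Since `B/ m` is 𝓑_{p-1}, `u` is p 𝓑_{p-1}.
    P N N⁻¹ u : ℚ
    P = fromℕ (suc n)
    N = fromℕ n
    N⁻¹ = + 1 / n
    u = P * B/ m

    ½∈ : ½ ∈Zp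
    ½∈ = ½-∈Zp p≢2

    B/∈ : ∀ {k} → k ℕ.< m → B/ k ∈Zp
    B/∈ {k} k<m = *-∈Zp (bernoulli-∈Zp (suc k) (s<s (s<s k<m))) (1/-<-∈Zp k (s<s (ℕ.<-trans k<m (ℕ.n<1+n m))))

  -- In the vanishing sum of C(p,k) B_k over k < p, the ends k = 0 and k = p-1 give 1 and p B_{p-1};
  -- the terms between are divisible by p.
  p*bernoulli+1-∈pZp : P * bernoulli n + 1ℚ ∈pZp
  p*bernoulli+1-∈pZp = subst _∈pZp (begin
    - S                                    ≡⟨ +-identityˡ (- S) ⟨
    0ℚ + - S                               ≡⟨ cong (_+ - S) (∑-bernoulli m) ⟨
    f 0 + ∑ n (f ∘ suc) + - S              ≡⟨ cong₂ (λ u v → u * 1ℚ + v + - S) (binom-0 (suc n)) (∑-last m (f ∘ suc)) ⟩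
    1ℚ * 1ℚ + (S + binom (suc n) n * bernoulli n) + - S
      ≡⟨ cong (λ u → 1ℚ * 1ℚ + (S + u * bernoulli n) + - S) (binom-n+1-n n) ⟩
    1ℚ * 1ℚ + (S + P * bernoulli n) + - S
      ≡⟨ solve 3 (λ s p b → con 1ℚ :* con 1ℚ :+ (s :+ p :* b) :+ (:- s) := p :* b :+ con 1ℚ) refl S P (bernoulli n) ⟩
    P * bernoulli n + 1ℚ                   ∎)
    (neg-∈pZp (∑-∈pZp m λ {k} k<m → subst _∈pZp (*-comm (bernoulli (suc k)) (binom (suc n) (suc k)))
      (*-∈pZp (bernoulli-∈Zp (suc k) (s<s (s<s k<m))) (binom-∈pZp p-prime (ℕ.<-trans k<m (ℕ.n<1+n m))))))
    where
    f : ℕ → ℚ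
    f k = binom (suc n) k * bernoulli k
    S : ℚ
    S = ∑ m (f ∘ suc)

  -- Here (p-1) `u` = p B_{p-1} ≡ -1, while p `u` ≡ 0; subtracting leaves `u` ≡ 1.
  p*B/-1-∈pZp : u + - 1ℚ ∈pZp
  p*B/-1-∈pZp = subst _∈pZp (begin
    P * u + - (P * b + 1ℚ)                  ≡⟨ solve 3 (λ p u b → p :* u :+ (:- (p :* b :+ con 1ℚ)) := p :* u :+ (:- (con 1ℚ :* (p :* b) :+ con 1ℚ))) refl P u b ⟩
    P * u + - (1ℚ * (P * b) + 1ℚ)           ≡⟨ cong (λ z → P * u + - (z * (P * b) + 1ℚ)) (*-inverse-fromℕ m) ⟨
    P * u + - (N * N⁻¹ * (P * b) + 1ℚ)      ≡⟨ solve 4 (λ p n r b → p :* (p :* (b :* r)) :+ (:- (n :* r :* (p :* b) :+ con 1ℚ)) :=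
                                                 p :* (p :* (b :* r)) :+ (:- (n :* (p :* (b :* r)) :+ con 1ℚ))) refl P N N⁻¹ b ⟩
    P * u + - (N * u + 1ℚ)                  ≡⟨ cong (λ z → z * u + - (N * u + 1ℚ)) (fromℕ-suc n) ⟩
    (1ℚ + N) * u + - (N * u + 1ℚ)           ≡⟨ solve 2 (λ n u → (con 1ℚ :+ n) :* u :+ (:- (n :* u :+ con 1ℚ)) := u :+ con (- 1ℚ)) refl N u ⟩
    u + - 1ℚ                                ∎)
    (+-∈pZp (p*-∈pZp u∈) (neg-∈pZp p*bernoulli+1-∈pZp))
    where
    b : ℚ
    b = bernoulli n
    -- p B_{p-1} is -1 plus a multiple of p, hence p-integral, and p-1 is invertible.
    u∈ : u ∈Zp
    u∈ = subst _∈Zp (solve 3 (λ p b r → (p :* b :+ con 1ℚ :+ con (- 1ℚ)) :* r := p :* (b :* r)) refl P b N⁻¹)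
      (*-∈Zp (+-∈Zp (∈pZp⇒∈Zp p*bernoulli+1-∈pZp) (fromℤ-∈Zp (ℤ.- + 1))) (1/-<-∈Zp m (ℕ.n<1+n n)))

  ∑-calB-∈pZp : ∑ (suc n) (λ k → calB (suc n) k * ½ ^ k) ∈pZp
  ∑-calB-∈pZp = subst _∈pZp (sym (begin
    - P⁻¹ * 1ℚ + A
      -- Adding and subtracting `S` puts the pole 1/p into `P⁻¹ + S`, which `∑-B/` evaluates.
      ≡⟨ solve 3 (λ q a s → (:- q) :* con 1ℚ :+ a := (a :+ s) :+ (:- (q :+ s))) refl P⁻¹ A S ⟩
    (A + S) + - (P⁻¹ + S)
      ≡⟨ cong₂ (λ u v → u + - v) (trans (sym (∑-+ n (λ k → B/ k * ½ ^ suc k) (λ k → binom n k * B/ k * -½ ^ suc k))) (∑-last m t)) (∑-B/ n) ⟩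
    ∑ m t + t m + - (½ * (1ℚ + H))
      -- For k = p-1 the signs agree because p-1 is even, and C(p-1,p-2) = p-1, so the term becomes
      -- `u * H`.
      ≡⟨ cong₂ (λ y c → ∑ m t + (B/ m * H + c * B/ m * y) + - (½ * (1ℚ + H))) -½^n≡½^n (binom-n+1-n m) ⟩
    ∑ m t + (B/ m * H + N * B/ m * H) + - (½ * (1ℚ + H))
      ≡⟨ solve 4 (λ s b n h → s :+ (b :* h :+ n :* b :* h) :+ (:- (con ½ :* (con 1ℚ :+ h))) :=
           s :+ (((con 1ℚ :+ n) :* b :+ con (- 1ℚ)) :* h :+ con ½ :* (h :+ (:- con 1ℚ)))) refl (∑ m t) (B/ m) N H ⟩
    ∑ m t + (((1ℚ + N) * B/ m + - 1ℚ) * H + ½ * (H + - 1ℚ))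
      -- Writing 1 as ½^n 2^n turns H - 1 into a multiple of 2^n - 1; a further factor ½ then
      -- exposes 2^p - 2 for `fermat-2`.
      ≡⟨ cong₂ (λ p o → ∑ m t + ((p * B/ m + - 1ℚ) * H + ½ * (H + - o))) (fromℕ-suc n) (½^n*2^n≡1 n) ⟨
    ∑ m t + ((u + - 1ℚ) * H + ½ * (H + - (H * (1ℚ + 1ℚ) ^ n)))
      ≡⟨ solve 4 (λ s v h w → s :+ (v :* h :+ con ½ :* (h :+ (:- (h :* w)))) :=
           s :+ (h :* v :+ (:- (con ½ :* con ½ :* h :* (con (1ℚ + 1ℚ) :* w :+ (:- con (1ℚ + 1ℚ)))))))
           refl (∑ m t) (u + - 1ℚ) H ((1ℚ + 1ℚ) ^ n) ⟩
    ∑ m t + (H * (u + - 1ℚ) + - (½ * ½ * H * ((1ℚ + 1ℚ) ^ suc n + - (1ℚ + 1ℚ)))) ∎))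
    (+-∈pZp (∑-∈pZp m t∈)
      (+-∈pZp (*-∈pZp H∈ p*B/-1-∈pZp) (neg-∈pZp (*-∈pZp (*-∈Zp (*-∈Zp ½∈ ½∈) H∈) (fermat-2 p-prime)))))
    where
    P⁻¹ H A S : ℚ
    P⁻¹ = + 1 / suc n
    H = ½ ^ n
    H∈ : H ∈Zp
    H∈ = ^-∈Zp ½∈ n
    t : ℕ → ℚ
    t k = B/ k * ½ ^ suc k + binom n k * B/ k * -½ ^ suc k
    A = ∑ n (λ k → B/ k * ½ ^ suc k)
    S = ∑ n (λ k → binom n k * B/ k * -½ ^ suc k)
    -½^n≡½^n : -½ ^ n ≡ H
    -½^n≡½^n with -½^n≡½^n⊎2∣1+n n
    -- An even p would equal 2, as 2 divides no other prime.
    ... | inj₁ eq  = eq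
    ... | inj₂ 2∣p with prime⇒irreducible p-prime 2∣p
    ...   | inj₂ 2≡p = ⊥-elim (p≢2 (sym 2≡p))
    -- The extra factor -½ in (-½)^(k+1) turns the sum `t k` into a p-integral multiple of ½^k -
    -- C(p-1,k) (-½)^k.
    t∈ : ∀ {k} → k ℕ.< m → t k ∈pZp
    t∈ {k} k<m = subst _∈pZp
      (solve 4 (λ b h c y → b :* con ½ :* (h :+ (:- (c :* y))) := b :* (con ½ :* h) :+ c :* b :* (con -½ :* y)) refl
        (B/ k) (½ ^ k) (binom n k) (-½ ^ k))
      (*-∈pZp (*-∈Zp (B/∈ k<m) ½∈) (½^k-binom*-½^k-∈pZp p-prime ½∈ (ℕ.m≤n⇒m≤1+n (ℕ.<⇒≤ k<m))))

theorem5 : (p : ℕ) → .{{_ : NonZero p}} → Prime p → p ≢ 2 →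
    InpZp p (sumℚ (map (λ k → calB p k * ((+ 1 / 2) ^ℚ k)) (upTo p)))
theorem5 (suc (suc m)) p-prime p≢2 = ∈pZp⇒InpZp (subst _∈pZp
  (cong sumℚ (sym (map-upTo (λ k → calB (suc (suc m)) k * ½ ^ k) (suc (suc m))))) (∑-calB-∈pZp p-prime p≢2))
  where open PAdic p-prime
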